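{- Let $p$ be an odd prime and $M$ the sub-add move matrix, with $t$, $k$, $i$ as in the context. (a) If $t$ is even, then $\Gamma_{M,\,p}$ has no secondary cycles. (b) If $t\equiv1\pmod 4$ and $(1+i)^t=i$, then all secondary cycles have length $t$. (c) If $t\equiv3\pmod4$ and $(1+i)^t=i$, then all secondary cycles have length $2t$. (d) If $t\equiv1\pmod4$ and $(1+i)^t=-i$, then all secondary cycles have length $2t$. (e) If $t\equiv3\pmod4$ and $(1+i)^t=-i$, then all secondary cycles have length $t$.
   Context: The sub-add move matrix is $M=\begin{pmatrix}1&-1\\1&1\end{pmatrix}$. $\Gamma_{M,\,p}$ is the directed graph with vertex set $\mathbb Z_p^2$ and arcs $((a,b),(a-b,a+b))$ (mod $p$; loops allowed). A directed cycle is a cycle in the underlying undirected graph such that in the induced directed subgraph every vertex has in- and out-degree $1$; a loop is a directed $1$-cycle. Let $t$ be the multiplicative order of $-4$ in $GF(p)$ and $k=4t$ (the $\mathbb Z_p$-order of $M$). Let $i\in GF(p^2)$ with $i^2=-1$, chosen so that ${\rm ord}(1-i)\le{\rm ord}(1+i)$ (multiplicative orders). A primary cycle is a directed cycle of length $k$; a secondary cycle is a directed cycle that is neither primary nor a $1$-cycle. -}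

module Defs where

open import Algebra.Apartness.Bundles using (HeytingCommutativeRing; HeytingField)
open import Algebra.Bundles using (CommutativeRing; RawRing)
import Algebra.Definitions.RawSemiring as SemiringDefinitions
open import Data.Fin.Base using (Fin; toℕ; fromℕ<)
open import Data.Integer.Base as ℤ using (ℤ; +_; -[1+_])
open import Data.Integer.DivMod using (_%ℕ_; n%ℕd<d)
open import Data.Nat.Base as ℕ using (ℕ; suc; NonZero)
open import Data.Nat.DivMod using (_mod_)
open import Data.Product using (_×_; _,_; ∃₂; ∃!)
open import Function.Bundles using (Inverse)
open import Function.Definitions using (Injective)
open import Level using (0ℓ; _⊔_)
open import Relation.Binary.Construct.Closure.Symmetric using (SymClosure)
open import Relation.Binary.PropositionalEquality using (_≡_; _≢_; setoid)
open import Relation.Nullary.Negation using (¬_)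

record Digraph : Set₁ where
  field
    Vertex : Set
    Arc    : Vertex → Vertex → Set

-- Indices are read cyclically.  The two degree fields say that the subgraph
-- induced on the vertices of the cycle has all out- and in-degrees 1.  Lengths
-- 1 and 2 are allowed: the degree fields then force the cycle to be a loop,
-- respectively a pair of opposite arcs (and not one arc traversed twice).
record DirectedCycle (G : Digraph) : Set where
  open Digraph G
  field
    length      : ℕ
    .{{nonZero}} : NonZero length
    vertex      : Fin length → Vertex
    distinct    : Injective _≡_ _≡_ vertex
    adjacent    : ∀ j → SymClosure Arc (vertex j) (vertex (suc (toℕ j) mod length))
    outDegree≡1 : ∀ j → ∃! _≡_ λ l → Arc (vertex j) (vertex l)
    inDegree≡1  : ∀ j → ∃! _≡_ λ l → Arc (vertex l) (vertex j)

module _ (p : ℕ) .{{_ : NonZero p}} where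

  residue : ℤ → Fin p
  residue z = fromℕ< (n%ℕd<d z p)

  ℤ/ : RawRing 0ℓ 0ℓ
  ℤ/ = record
    { Carrier = Fin p
    ; _≈_     = _≡_
    ; _+_     = λ a b → residue (+ toℕ a ℤ.+ + toℕ b)
    ; _*_     = λ a b → residue (+ toℕ a ℤ.* + toℕ b)
    ; -_      = λ a → residue (ℤ.- + toℕ a)
    ; 0#      = residue (+ 0)
    ; 1#      = residue (+ 1)
    }

  -- The graph Γ_{M,p} of the matrix M = (1 -1 ; 1 1).
  Γ : Digraph
  Γ = record
    { Vertex = Fin p × Fin p
    ; Arc    = λ (a , b) v → v ≡ (a + (- b) , a + b)
    }
    where open RawRing ℤ/

-- n is the multiplicative order of x.
record IsOrder {c ℓ} (R : RawRing c ℓ) (x : RawRing.Carrier R) (n : ℕ) : Set ℓ where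
  open RawRing R using (rawSemiring; _≈_; 1#)
  open SemiringDefinitions rawSemiring using (_^_)
  field
    positive : 0 ℕ.< n
    x^n≈1    : x ^ n ≈ 1#
    minimal  : ∀ m → 0 ℕ.< m → x ^ m ≈ 1# → n ℕ.≤ m

IsOrderOf-4 : (p : ℕ) .{{_ : NonZero p}} → ℕ → Set
IsOrderOf-4 p t = IsOrder (ℤ/ p) (residue p -[1+ 3 ]) t

-- The parameter t stands for the order of -4 in GF(p), so that k = 4t is the
-- order of M over GF(p).
IsPrimary : ∀ {G} → ℕ → DirectedCycle G → Set
IsPrimary t C = DirectedCycle.length C ≡ 4 ℕ.* t

IsSecondary : ∀ {G} → ℕ → DirectedCycle G → Set
IsSecondary t C = ¬ IsPrimary t C × DirectedCycle.length C ≢ 1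

module FieldNotation {c ℓ₁ ℓ₂} (F : HeytingField c ℓ₁ ℓ₂) where
  open HeytingField F public
    using (Carrier; _≈_; _+_; _-_; _*_; -_; 1#)

  fieldRing : RawRing c ℓ₁
  fieldRing = CommutativeRing.rawRing
    (HeytingCommutativeRing.commutativeRing (HeytingField.heytingCommutativeRing F))

  open SemiringDefinitions (RawRing.rawSemiring fieldRing) public using (_^_)

-- F is GF(q).  A bijection with Fin q makes equality and invertibility in F
-- decidable, so a Heyting field with q elements is exactly a field with q
-- elements in the classical sense.
IsGF : ∀ {c ℓ₁ ℓ₂} → HeytingField c ℓ₁ ℓ₂ → ℕ → Set (c ⊔ ℓ₁)
IsGF F q = Inverse (record { isEquivalence = HeytingField.isEquivalence F }) (setoid (Fin q))

-- i² = -1 and ord (1 - i) ≤ ord (1 + i).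
IsChosenI : ∀ {c ℓ₁ ℓ₂} (F : HeytingField c ℓ₁ ℓ₂) → HeytingField.Carrier F → Set ℓ₁
IsChosenI F i = i * i ≈ - 1# × ∃₂ λ m n →
  IsOrder fieldRing (1# - i) m × IsOrder fieldRing (1# + i) n × m ℕ.≤ n
  where open FieldNotation F

-- Identify (a , b) with a + b i, so that M is multiplication by 1 + i and
-- M⁴ = -4.  A directed cycle is exactly an M-orbit, and its length is the period
-- of any of its vertices v.  If v ≠ 0, every period is a multiple of t and 4t is
-- one, so a secondary cycle satisfies M²ᵗ v = v.  For t = 2s this reads
-- (-4)ˢ v = v, against the minimality of t.  For odd t the matrix Mᵗ corresponds
-- to y (δ + i) with δ = ±1 according to t mod 4, so (1 + i)ᵗ = ε i with ε = ±1
-- forces i into the prime field, say i = e.  Then M²ᵗ v = v puts v into the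
-- eigenspace of M for 1 - e, where Mᵗ acts as y (δ - e) = δ ε.
module Submission where

open import Defs
open import Algebra.Apartness.Bundles using (HeytingField; HeytingCommutativeRing)
import Algebra.Apartness.Properties.HeytingCommutativeRing as HeytingProperties
open import Algebra.Bundles using (CommutativeRing; RawRing)
import Algebra.Morphism.RingMonomorphism as RingMonomorphism
open import Algebra.Morphism.Structures using (IsRingMonomorphism)
import Algebra.Properties.CommutativeMonoid.Sum as Sum
import Algebra.Properties.Group as GroupProperties
import Algebra.Properties.Ring as RingProperties
import Algebra.Properties.Semiring.Exp as Exp
import Algebra.Properties.Semiring.Mult as Mult
import Algebra.Solver.Ring as RingSolver
open import Algebra.Solver.Ring.AlmostCommutativeRing using (fromCommutativeRing; _-Raw-AlmostCommutative⟶_)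
open import Algebra.Structures using (IsCommutativeRing)
open import Data.Fin.Base using (Fin; toℕ)
open import Data.Fin.Permutation using (Permutation; permutation)
import Data.Fin.Properties as Fin
open import Data.Fin.Properties using (toℕ-injective; toℕ-fromℕ<; toℕ<n; injective⇒≤)
open import Data.Integer.Base as ℤ using (ℤ; +_; -[1+_])
open import Data.Integer.DivMod using (_%ℕ_; _/ℕ_; n%ℕd<d; a≡a%ℕn+[a/ℕn]*n)
import Data.Integer.Divisibility.Signed as ℤ
import Data.Integer.Properties as ℤ
open import Data.Integer.Tactic.RingSolver using (solve-∀)
open import Data.Maybe.Base using (Maybe; just; nothing)
open import Data.Nat.Base as ℕ using (ℕ; zero; suc; NonZero; _%_; z<s)
open import Data.Nat.Coprimality using (prime⇒coprime; coprime-Bézout)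
open import Data.Nat.DivMod using (_mod_; m<n⇒m%n≡m; m≡m%n+[m/n]*n; m%n<n)
open import Data.Nat.Divisibility as ℕ using (_∣_; divides; ∣⇒≤; m%n≡0⇒n∣m)
open import Data.Nat.GCD using (module Bézout)
open import Data.Nat.GeneralisedArithmetic using (fold; fold-+)
open import Data.Nat.Primality using (Prime)
import Data.Nat.Properties as ℕ
open import Data.Product using (_×_; _,_; ∃; proj₁; proj₂)
open import Data.Product.Properties using (≡-dec)
open import Data.Sum.Base using (inj₁; inj₂)
open import Data.Vec.Functional using (replicate)
open import Function.Base using (_∘_)
open import Function.Bundles using (Inverse)
open import Level using (0ℓ)
open import Relation.Binary.Construct.Closure.Symmetric using (fwd; bwd)
open import Relation.Binary.Definitions using (tri<; tri≈; tri>)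
open import Relation.Binary.PropositionalEquality as ≡ using (_≡_; _≢_)
import Relation.Binary.Reasoning.Setoid as ≈-Reasoning
open import Relation.Nullary.Decidable using (yes; no; decidable-stable)
open import Relation.Nullary.Negation using (¬_; contradiction)

-- Periods and minimal periods of the iterates of a function.

module Orbit {A : Set} (f : A → A) (x : A) where

  open import Data.Nat.Base using (_+_; _*_; _∸_; _/_; _<_)
  open ≡ using (refl; sym; trans; cong; subst)

  IsPeriod : ℕ → Set
  IsPeriod n = fold x f n ≡ x

  IsMinimalPeriod : ℕ → Set
  IsMinimalPeriod n = 0 < n × IsPeriod n × (∀ m → 0 < m → m < n → ¬ IsPeriod m)

  fold-period : ∀ {n} → IsPeriod n → ∀ m → fold x f (m + n) ≡ fold x f m
  fold-period {n} per m = trans (fold-+ x f m) (cong (λ z → fold z f m) per)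

  *-period : ∀ {n} → IsPeriod n → ∀ k → IsPeriod (k * n)
  *-period per zero = refl
  *-period {n} per (suc k) =
    trans (fold-period {k * n} (*-period per k) n) per

  fold-% : ∀ {n} .{{_ : NonZero n}} → IsPeriod n → ∀ m → fold x f m ≡ fold x f (m % n)
  fold-% {n} per m =
    trans (cong (fold x f) (m≡m%n+[m/n]*n m n))
          (fold-period {m / n * n} (*-period per (m / n)) (m % n))

  private
    -- If steps `a` and `b` agree, running both for `n ∸ b` further steps brings the second back to
    -- `x`, so `n ∸ b + a` is a period strictly between 0 and `n`.
    fold-distinct-< : ∀ {n} → IsMinimalPeriod n → ∀ {a b} → a < b → b < n → fold x f a ≢ fold x f b
    fold-distinct-< {n} (_ , per , min) {a} {b} a<b b<n eq =
      min (n ∸ b + a) (ℕ.<-≤-trans (ℕ.m<n⇒0<n∸m b<n) (ℕ.m≤m+n (n ∸ b) a))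
        (subst (n ∸ b + a <_) (ℕ.m∸n+n≡m (ℕ.<⇒≤ b<n)) (ℕ.+-monoʳ-< (n ∸ b) a<b))
        (begin
          fold x f (n ∸ b + a)         ≡⟨ fold-+ x f (n ∸ b) ⟩
          fold (fold x f a) f (n ∸ b)  ≡⟨ cong (λ z → fold z f (n ∸ b)) eq ⟩
          fold (fold x f b) f (n ∸ b)  ≡⟨ fold-+ x f (n ∸ b) ⟨
          fold x f (n ∸ b + b)         ≡⟨ cong (fold x f) (ℕ.m∸n+n≡m (ℕ.<⇒≤ b<n)) ⟩
          fold x f n                   ≡⟨ per ⟩
          x                            ∎)
      where open ≡.≡-Reasoning

  -- The remainder of `m` modulo `n` is again a period and is smaller than `n`, so minimality makes
  -- it 0.
  minimalPeriod∣period : ∀ {n} → IsMinimalPeriod n → ∀ {m} → IsPeriod m → n ∣ m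
  minimalPeriod∣period {n} (0<n , per , min) {m} perₘ = m%n≡0⇒n∣m m n (remainder≡0 (m % n) refl)
    where
    instance
      n≢0 : NonZero n
      n≢0 = ℕ.>-nonZero 0<n
    remainder≡0 : ∀ r → m % n ≡ r → m % n ≡ 0
    remainder≡0 zero    eq = eq
    remainder≡0 (suc r) eq = contradiction
      (trans (cong (fold x f) (sym eq)) (trans (sym (fold-% per m)) perₘ))
      (min (suc r) z<s (subst (_< n) eq (m%n<n m n)))

  fold-distinct : ∀ {n} → IsMinimalPeriod n → ∀ {a b} → a < n → b < n →
                  fold x f a ≡ fold x f b → a ≡ b
  fold-distinct minimal {a} {b} a<n b<n eq with ℕ.<-cmp a b
  ... | tri< a<b _ _ = contradiction eq (fold-distinct-< minimal a<b b<n)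
  ... | tri≈ _ a≡b _ = a≡b
  ... | tri> _ _ b<a = contradiction (sym eq) (fold-distinct-< minimal b<a a<n)

  module PeriodsBetween {t} (0<t : 0 < t) (t∣ : ∀ n → IsPeriod n → t ∣ n)
                        (4t-period : IsPeriod (4 * t)) where

    4t-minimal : ¬ IsPeriod (2 * t) → IsMinimalPeriod (4 * t)
    4t-minimal ¬2t = ℕ.<-≤-trans 0<t (ℕ.m≤m+n t _) , 4t-period , minimal′
      where
      minimal′ : ∀ m → 0 < m → m < 4 * t → ¬ IsPeriod m
      minimal′ m 0<m m<4t per with t∣ m per
      ... | divides 0 refl = contradiction 0<m λ ()
      ... | divides 1 refl = ¬2t (*-period {t} (trans (cong (fold x f) (sym (ℕ.*-identityˡ t))) per) 2)
      ... | divides 2 refl = ¬2t per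
      -- From the periods `3 * t` and `4 * t` their difference `t` is a period, and hence so is
      -- `2 * t`.
      ... | divides 3 refl = ¬2t (*-period {t} (trans (sym (fold-period {3 * t} per t)) 4t-period) 2)
      ... | divides (suc (suc (suc (suc k)))) refl =
        contradiction m<4t (ℕ.≤⇒≯ (ℕ.*-monoˡ-≤ t (ℕ.m≤m+n 4 k)))

    t-minimal : IsPeriod t → IsMinimalPeriod t
    t-minimal per = 0<t , per , λ m 0<m m<t perₘ →
      ℕ.<⇒≱ m<t (∣⇒≤ {{ℕ.>-nonZero 0<m}} (t∣ m perₘ))

    2t-minimal : ¬ IsPeriod t → IsPeriod (2 * t) → IsMinimalPeriod (2 * t)
    2t-minimal ¬t per = ℕ.<-≤-trans 0<t (ℕ.m≤m+n t _) , per , minimal′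
      where
      minimal′ : ∀ m → 0 < m → m < 2 * t → ¬ IsPeriod m
      minimal′ m 0<m m<2t perₘ with t∣ m perₘ
      ... | divides 0 refl = contradiction 0<m λ ()
      ... | divides 1 refl = ¬t (trans (cong (fold x f) (sym (ℕ.*-identityˡ t))) perₘ)
      ... | divides (suc (suc k)) refl =
        contradiction m<2t (ℕ.≤⇒≯ (ℕ.*-monoˡ-≤ t (ℕ.m≤m+n 2 k)))

-- Directed cycles of a functional digraph as orbits.

module FunctionalDigraph
  (G : Digraph) (f : Digraph.Vertex G → Digraph.Vertex G)
  (arc⇒≡ : ∀ {u w} → Digraph.Arc G u w → w ≡ f u)
  (arc : ∀ u → Digraph.Arc G u (f u))
  (C : DirectedCycle G) where

  open import Data.Nat.Base using (_<_)
  open ≡ using (refl; sym; trans; cong; subst)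
  open Digraph G
  open DirectedCycle C renaming (length to L)

  start : Fin L
  start = 0 mod L

  open Orbit f (vertex start)

  private
    -- Enumerates the indices by the cyclic successor that `adjacent` uses, so that an induction on
    -- the number of steps reaches every index.
    walk : ℕ → Fin L
    walk zero    = start
    walk (suc k) = suc (toℕ (walk k)) mod L

    toℕ-mod : ∀ {k} → k < L → toℕ (k mod L) ≡ k
    toℕ-mod {k} k<L = trans (toℕ-fromℕ< (m%n<n k L)) (m<n⇒m%n≡m k<L)

    toℕ-walk : ∀ k → k < L → toℕ (walk k) ≡ k
    toℕ-walk zero    0<L = toℕ-mod 0<L
    toℕ-walk (suc k) k<L
      rewrite toℕ-walk k (ℕ.<-trans (ℕ.n<1+n k) k<L) = toℕ-mod k<L

    walk-toℕ : ∀ j → walk (toℕ j) ≡ j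
    walk-toℕ j = toℕ-injective (toℕ-walk (toℕ j) (toℕ<n j))

    -- The out-degree condition supplies an arc that stays on the cycle, and the only arc leaving a
    -- vertex goes to its image under `f`.
    orbit⊆cycle : ∀ m → ∃ λ j → vertex j ≡ fold (vertex start) f m
    orbit⊆cycle zero    = start , refl
    orbit⊆cycle (suc m) =
      let j , eq = orbit⊆cycle m
          k , j⟶k , _ = outDegree≡1 j
      in k , trans (arc⇒≡ j⟶k) (cong f eq)

    -- Consecutive vertices are adjacent in an unknown direction. A forward arc is one more
    -- application of `f`. For a backward arc, the preceding orbit point also lies on the cycle and
    -- also has an arc into the current vertex, so in-degree 1 identifies it with the next vertex.
    cycle⊆orbit : ∀ {n} → IsMinimalPeriod n → ∀ k →
                  ∃ λ m → vertex (walk k) ≡ fold (vertex start) f m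
    cycle⊆orbit _ zero = 0 , refl
    cycle⊆orbit {suc n} minimal@(_ , per , _) (suc k)
      with adjacent (walk k) | cycle⊆orbit minimal k
    ... | fwd k⟶k+1 | m , eq = suc m , trans (arc⇒≡ k⟶k+1) (cong f eq)
    ... | bwd k+1⟶k | m , eq = predecessor m eq
      where
      predecessor : ∀ m → vertex (walk k) ≡ fold (vertex start) f m →
                    ∃ λ m → vertex (walk (suc k)) ≡ fold (vertex start) f m
      -- The base point has no earlier iterate; by periodicity it is also iterate number `suc n`,
      -- which has one.
      predecessor zero    eq = predecessor (suc n) (trans eq (sym per))
      predecessor (suc m) eq =
        let j , eqⱼ = orbit⊆cycle m
            _ , _ , unique = inDegree≡1 (walk k)
            j⟶k = subst (Arc (vertex j)) (trans (cong f eqⱼ) (sym eq)) (arc (vertex j))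
        in m , trans (cong vertex (trans (sym (unique k+1⟶k)) (unique j⟶k))) eqⱼ

  -- Two injections compare the sizes: cycle indices go to exponents reduced modulo `n`, and
  -- exponents below `n` go to cycle indices.
  length≡minimalPeriod : ∀ {n} → IsMinimalPeriod n → L ≡ n
  length≡minimalPeriod {n} minimal@(0<n , per , _) =
    ℕ.≤-antisym (injective⇒≤ index-injective) (injective⇒≤ orbit-injective)
    where
    instance
      n≢0 : NonZero n
      n≢0 = ℕ.>-nonZero 0<n

    index : ∀ j → ∃ λ (m : Fin n) → vertex j ≡ fold (vertex start) f (toℕ m)
    index j =
      let m , eq = cycle⊆orbit minimal (toℕ j)
      in m mod n , (begin
        vertex j                              ≡⟨ cong vertex (walk-toℕ j) ⟨
        vertex (walk (toℕ j))                 ≡⟨ eq ⟩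
        fold (vertex start) f m               ≡⟨ fold-% per m ⟩
        fold (vertex start) f (m % n)         ≡⟨ cong (fold (vertex start) f) (toℕ-fromℕ< (m%n<n m n)) ⟨
        fold (vertex start) f (toℕ (m mod n)) ∎)
      where open ≡.≡-Reasoning

    index-injective : ∀ {j k} → proj₁ (index j) ≡ proj₁ (index k) → j ≡ k
    index-injective {j} {k} eq = distinct
      (trans (proj₂ (index j)) (trans (cong (fold (vertex start) f ∘ toℕ) eq) (sym (proj₂ (index k)))))

    orbit-injective : ∀ {a b : Fin n} →
      proj₁ (orbit⊆cycle (toℕ a)) ≡ proj₁ (orbit⊆cycle (toℕ b)) → a ≡ b
    orbit-injective {a} {b} eq = toℕ-injective (fold-distinct minimal (toℕ<n a) (toℕ<n b)
      (trans (sym (proj₂ (orbit⊆cycle (toℕ a)))) (trans (cong vertex eq) (proj₂ (orbit⊆cycle (toℕ b))))))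

-- The commutative ring of integers modulo p.

module IntegersModulo (p : ℕ) .{{_ : NonZero p}} where

  open ≡ using (refl; sym; trans; cong; subst)

  infix 4 _∼_
  -- A record keeps `x` and `y` visible to unification, which could not recover them from their
  -- difference.
  record _∼_ (x y : ℤ) : Set where
    constructor congruent
    field p∣x-y : + p ℤ.∣ x ℤ.- y

  private
    congruent′ : ∀ {x y z} → z ≡ x ℤ.- y → + p ℤ.∣ z → x ∼ y
    congruent′ refl = congruent

    ∼-reflexive : ∀ {x y} → x ≡ y → x ∼ y
    ∼-reflexive {x} refl = congruent′ (sym (ℤ.+-inverseʳ x)) (ℤ.divides (+ 0) refl)

    ∼-sym : ∀ {x y} → x ∼ y → y ∼ x
    ∼-sym {x} {y} (congruent p∣) = congruent′ (lemma x y) (ℤ.∣m⇒∣-m p∣)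
      where
      lemma : ∀ x y → ℤ.- (x ℤ.- y) ≡ y ℤ.- x
      lemma = solve-∀

    ∼-trans : ∀ {x y z} → x ∼ y → y ∼ z → x ∼ z
    ∼-trans {x} {y} {z} (congruent p∣₁) (congruent p∣₂) = congruent′ (lemma x y z) (ℤ.∣m∣n⇒∣m+n p∣₁ p∣₂)
      where
      lemma : ∀ x y z → (x ℤ.- y) ℤ.+ (y ℤ.- z) ≡ x ℤ.- z
      lemma = solve-∀

    ∼-+-cong : ∀ {x y u v} → x ∼ y → u ∼ v → x ℤ.+ u ∼ y ℤ.+ v
    ∼-+-cong {x} {y} {u} {v} (congruent p∣₁) (congruent p∣₂) = congruent′ (lemma x y u v) (ℤ.∣m∣n⇒∣m+n p∣₁ p∣₂)
      where
      lemma : ∀ x y u v → (x ℤ.- y) ℤ.+ (u ℤ.- v) ≡ (x ℤ.+ u) ℤ.- (y ℤ.+ v)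
      lemma = solve-∀

    ∼-*-cong : ∀ {x y u v} → x ∼ y → u ∼ v → x ℤ.* u ∼ y ℤ.* v
    ∼-*-cong {x} {y} {u} {v} (congruent p∣₁) (congruent p∣₂) =
      congruent′ (lemma x y u v) (ℤ.∣m∣n⇒∣m+n (ℤ.∣m⇒∣m*n u p∣₁) (ℤ.∣n⇒∣m*n y p∣₂))
      where
      lemma : ∀ x y u v → (x ℤ.- y) ℤ.* u ℤ.+ y ℤ.* (u ℤ.- v) ≡ x ℤ.* u ℤ.- y ℤ.* v
      lemma = solve-∀

    ∼-neg-cong : ∀ {x y} → x ∼ y → ℤ.- x ∼ ℤ.- y
    ∼-neg-cong {x} {y} (congruent p∣) = congruent′ (lemma x y) (ℤ.∣m⇒∣-m p∣)
      where
      lemma : ∀ x y → ℤ.- (x ℤ.- y) ≡ ℤ.- x ℤ.- ℤ.- y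
      lemma = solve-∀

    ℤ-mod : RawRing 0ℓ 0ℓ
    ℤ-mod = record
      { Carrier = ℤ ; _≈_ = _∼_ ; _+_ = ℤ._+_ ; _*_ = ℤ._*_ ; -_ = ℤ.-_ ; 0# = + 0 ; 1# = + 1 }

    ℤ-mod-isCommutativeRing : IsCommutativeRing _∼_ ℤ._+_ ℤ._*_ ℤ.-_ (+ 0) (+ 1)
    ℤ-mod-isCommutativeRing = record
      { isRing = record
        { +-isAbelianGroup = record
          { isGroup = record
            { isMonoid = record
              { isSemigroup = record
                { isMagma = record
                  { isEquivalence = record
                    { refl = ∼-reflexive refl ; sym = ∼-sym ; trans = ∼-trans }
                  ; ∙-cong = ∼-+-cong
                  }
                ; assoc = λ x y z → ∼-reflexive (ℤ.+-assoc x y z)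
                }
              ; identity = (λ x → ∼-reflexive (ℤ.+-identityˡ x)) , (λ x → ∼-reflexive (ℤ.+-identityʳ x))
              }
            ; inverse = (λ x → ∼-reflexive (ℤ.+-inverseˡ x)) , (λ x → ∼-reflexive (ℤ.+-inverseʳ x))
            ; ⁻¹-cong = ∼-neg-cong
            }
          ; comm = λ x y → ∼-reflexive (ℤ.+-comm x y)
          }
        ; *-cong = ∼-*-cong
        ; *-assoc = λ x y z → ∼-reflexive (ℤ.*-assoc x y z)
        ; *-identity = (λ x → ∼-reflexive (ℤ.*-identityˡ x)) , (λ x → ∼-reflexive (ℤ.*-identityʳ x))
        ; distrib = (λ x y z → ∼-reflexive (ℤ.*-distribˡ-+ x y z)) , (λ x y z → ∼-reflexive (ℤ.*-distribʳ-+ x y z))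
        }
      ; *-comm = λ x y → ∼-reflexive (ℤ.*-comm x y)
      }

  lift : Fin p → ℤ
  lift a = + toℕ a

  private
    -- The difference `m ∸ n` is a multiple of `p` and is below `p`, hence 0.
    ∼⇒≡ : ∀ {m n} → m ℕ.< p → n ℕ.≤ m → + m ∼ + n → m ≡ n
    ∼⇒≡ {m} {n} m<p n≤m (congruent p∣) with m ℕ.∸ n in eq
    ... | 0     = ℕ.≤-antisym (ℕ.m∸n≡0⇒m≤n eq) n≤m
    ... | suc d = contradiction
      (subst (p ℕ.∣_) (trans (cong ℤ.∣_∣ (trans (ℤ.m-n≡m⊖n m n) (ℤ.⊖-≥ n≤m))) eq) (ℤ.∣⇒∣ᵤ p∣))
      (ℕ.>⇒∤ (subst (ℕ._< p) eq (ℕ.≤-<-trans (ℕ.m∸n≤m m n) m<p)))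

  lift-injective : ∀ {a b} → lift a ∼ lift b → a ≡ b
  lift-injective {a} {b} a∼b with ℕ.≤-total (toℕ b) (toℕ a)
  ... | inj₁ b≤a = toℕ-injective (∼⇒≡ (toℕ<n a) b≤a a∼b)
  ... | inj₂ a≤b = toℕ-injective (sym (∼⇒≡ (toℕ<n b) a≤b (∼-sym a∼b)))

  lift-residue : ∀ z → lift (residue p z) ∼ z
  lift-residue z = ∼-sym (congruent (ℤ.divides (z /ℕ p) (begin
    z ℤ.- lift (residue p z)                       ≡⟨ cong (λ r → z ℤ.- + r) (toℕ-fromℕ< (n%ℕd<d z p)) ⟩
    z ℤ.- + (z %ℕ p)                               ≡⟨ cong (ℤ._- + (z %ℕ p)) (a≡a%ℕn+[a/ℕn]*n z p) ⟩
    (+ (z %ℕ p) ℤ.+ z /ℕ p ℤ.* + p) ℤ.- + (z %ℕ p) ≡⟨ lemma (+ (z %ℕ p)) (z /ℕ p ℤ.* + p) ⟩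
    z /ℕ p ℤ.* + p                                 ∎)))
    where
    open ≡.≡-Reasoning
    lemma : ∀ x y → (x ℤ.+ y) ℤ.- x ≡ y
    lemma = solve-∀

  residue-cong : ∀ {y z} → y ∼ z → residue p y ≡ residue p z
  residue-cong {y} {z} y∼z = lift-injective
    (∼-trans (lift-residue y) (∼-trans y∼z (∼-sym (lift-residue z))))

  private
    -- The ring laws on `Fin p` are pulled back from ℤ under congruence: taking representatives is
    -- injective and respects the operations up to `∼`.
    lift-isRingMonomorphism : IsRingMonomorphism (ℤ/ p) ℤ-mod lift
    lift-isRingMonomorphism = record
      { isRingHomomorphism = record
        { isSemiringHomomorphism = record
          { isNearSemiringHomomorphism = record
            { +-isMonoidHomomorphism = record
              { isMagmaHomomorphism = record
                { isRelHomomorphism = record { cong = λ { refl → ∼-reflexive refl } }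
                ; homo = λ a b → lift-residue (lift a ℤ.+ lift b)
                }
              ; ε-homo = lift-residue (+ 0)
              }
            ; *-homo = λ a b → lift-residue (lift a ℤ.* lift b)
            }
          ; 1#-homo = lift-residue (+ 1)
          }
        ; -‿homo = λ a → lift-residue (ℤ.- lift a)
        }
      ; injective = lift-injective
      }

  commutativeRing : CommutativeRing 0ℓ 0ℓ
  commutativeRing = record
    { isCommutativeRing =
        RingMonomorphism.isCommutativeRing lift-isRingMonomorphism ℤ-mod-isCommutativeRing }

  open CommutativeRing commutativeRing using (_+_; _*_; -_)

  residue-+ : ∀ y z → residue p (y ℤ.+ z) ≡ residue p y + residue p z
  residue-+ y z = residue-cong (∼-+-cong (∼-sym (lift-residue y)) (∼-sym (lift-residue z)))

  residue-* : ∀ y z → residue p (y ℤ.* z) ≡ residue p y * residue p z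
  residue-* y z = residue-cong (∼-*-cong (∼-sym (lift-residue y)) (∼-sym (lift-residue z)))

  residue-neg : ∀ z → residue p (ℤ.- z) ≡ - residue p z
  residue-neg z = residue-cong (∼-neg-cong (∼-sym (lift-residue z)))

  residue-lift : ∀ a → residue p (lift a) ≡ a
  residue-lift a = lift-injective (lift-residue (lift a))

-- Polynomial identities for M over a commutative ring.

ℤ-rawRing : RawRing 0ℓ 0ℓ
ℤ-rawRing = CommutativeRing.rawRing ℤ.+-*-commutativeRing

-- The identities are needed both modulo p and in the field with p² elements. The morphism from ℤ
-- interprets the numerals of the ring solver in either ring.
module SubAdd {c ℓ} (R : CommutativeRing c ℓ)
  (ℤ⟶R : ℤ-rawRing -Raw-AlmostCommutative⟶ fromCommutativeRing R) where

  open CommutativeRing R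
  open _-Raw-AlmostCommutative⟶_ ℤ⟶R using (⟦_⟧; 1-homo)
  open RingProperties ring using (x≈y⇒x∙y⁻¹≈ε; x∙y⁻¹≈ε⇒x≈y; -0#≈0#; -1*x≈-x)

  private
    _coeff≟_ : ∀ m n → Maybe (⟦ m ⟧ ≈ ⟦ n ⟧)
    m coeff≟ n with m ℤ.≟ n
    ... | yes m≡n = just (reflexive (≡.cong ⟦_⟧ m≡n))
    ... | no  _   = nothing

  open RingSolver ℤ-rawRing (fromCommutativeRing R) ℤ⟶R _coeff≟_
    using (Polynomial; solve; _:=_; _:+_; _:*_; _:-_; :-_; con)

  Pair : Set c
  Pair = Carrier × Carrier

  infix 4 _≋_
  _≋_ : Pair → Pair → Set ℓ
  (a , b) ≋ (c , d) = a ≈ c × b ≈ d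

  M : Pair → Pair
  M (a , b) = a + - b , a + b

  infixr 7 _•_
  _•_ : Carrier → Pair → Pair
  c • (a , b) = c * a , c * b

  -- Multiplication of a + b i; thus M v = (1 , 1) ⊗ v.
  infixr 7 _⊗_
  _⊗_ : Pair → Pair → Pair
  (x , y) ⊗ (a , b) = x * a + - (y * b) , x * b + y * a

  private
    Pair′ : _ → Set _
    Pair′ n = Polynomial n × Polynomial n

    M′ : ∀ {n} → Pair′ n → Pair′ n
    M′ (a , b) = a :+ :- b , a :+ b

    _⊗′_ : ∀ {n} → Pair′ n → Pair′ n → Pair′ n
    (x , y) ⊗′ (a , b) = x :* a :+ :- (y :* b) , x :* b :+ y :* a

  M⁴≋-4• : ∀ v → M (M (M (M v))) ≋ ⟦ -[1+ 3 ] ⟧ • v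
  M⁴≋-4• (a , b) =
      solve 2 (λ a b → proj₁ (M′ (M′ (M′ (M′ (a , b))))) := con -[1+ 3 ] :* a) refl a b
    , solve 2 (λ a b → proj₂ (M′ (M′ (M′ (M′ (a , b))))) := con -[1+ 3 ] :* b) refl a b

  -- Since `M` is multiplication by (1 , 1), this is associativity of the product of Gaussian pairs.
  M-⊗ : ∀ u v → M (u ⊗ v) ≋ M u ⊗ v
  M-⊗ (x , y) (a , b) =
      solve 4 (λ x y a b → proj₁ (M′ ((x , y) ⊗′ (a , b))) := proj₁ (M′ (x , y) ⊗′ (a , b))) refl x y a b
    , solve 4 (λ x y a b → proj₂ (M′ ((x , y) ⊗′ (a , b))) := proj₂ (M′ (x , y) ⊗′ (a , b))) refl x y a b

  ⊗-identityˡ : ∀ v → (1# , 0#) ⊗ v ≋ v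
  ⊗-identityˡ (a , b) =
      trans (+-cong (*-identityˡ a) (trans (-‿cong (zeroˡ b)) -0#≈0#)) (+-identityʳ a)
    , trans (+-cong (*-identityˡ b) (zeroˡ a)) (+-identityʳ b)

  private
    infixr 6 _⊞_
    _⊞_ : ∀ {x y} → x ≈ 0# → y ≈ 0# → x + y ≈ 0#
    x≈0 ⊞ y≈0 = trans (+-cong x≈0 y≈0) (+-identityˡ 0#)

    infixr 7 _⊡_
    _⊡_ : ∀ k {x} → x ≈ 0# → k * x ≈ 0#
    k ⊡ x≈0 = trans (*-congˡ x≈0) (zeroʳ k)

    -- x ≈ y is derived by writing x - y as a linear combination, with
    -- polynomial coefficients, of the differences that the hypotheses kill.
    combination : ∀ {x y s} → x - y ≈ s → s ≈ 0# → x ≈ y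
    combination {x} {y} x-y≈s s≈0 = x∙y⁻¹≈ε⇒x≈y x y (trans x-y≈s s≈0)

    difference : ∀ {x y} → x ≈ y → x - y ≈ 0#
    difference {x} {y} = x≈y⇒x∙y⁻¹≈ε {x} {y}

    square≈1 : ∀ {δ} → δ * δ ≈ 1# → δ * δ - ⟦ + 1 ⟧ ≈ 0#
    square≈1 eq = difference (trans eq (sym 1-homo))

    square≈-1 : ∀ {e} → e * e ≈ - 1# → e * e + ⟦ + 1 ⟧ ≈ 0#
    square≈-1 {e} eq = trans (+-cong eq 1-homo) (-‿inverseˡ 1#)

  -- The factor `1#` is the sign δ: this and `M³-axis` put their results into the common shape
  -- `(δ * y , y)`.
  M-axis : ∀ {a b x} → a ≈ x → b ≈ 0# → M (a , b) ≋ (1# * x , x)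
  M-axis {a} {b} {x} a≈x b≈0 =
      trans (trans (+-cong a≈x (trans (-‿cong b≈0) -0#≈0#)) (+-identityʳ x)) (sym (*-identityˡ x))
    , trans (+-cong a≈x b≈0) (+-identityʳ x)

  -- This is (1 + i)³ = -2 + 2i, so δ = -1 and y = 2x.
  M³-axis : ∀ {a b x} → a ≈ x → b ≈ 0# → M (M (M (a , b))) ≋ (- 1# * (x + x) , x + x)
  M³-axis {a} {b} {x} a≈x b≈0 =
      trans (combination
        (solve 3 (λ a b x →
          proj₁ (M′ (M′ (M′ (a , b)))) :- :- (x :+ x) :=
          :- con (+ 2) :* (a :- x) :+ :- con (+ 2) :* b) refl a b x)
        (_ ⊡ difference a≈x ⊞ _ ⊡ b≈0)) (sym (-1*x≈-x (x + x)))
    , combination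
        (solve 3 (λ a b x →
          proj₂ (M′ (M′ (M′ (a , b)))) :- (x :+ x) :=
          con (+ 2) :* (a :- x) :+ :- con (+ 2) :* b) refl a b x)
        (_ ⊡ difference a≈x ⊞ _ ⊡ b≈0)

  1+1≈0⇒-4≈0 : 1# + 1# ≈ 0# → ⟦ -[1+ 3 ] ⟧ ≈ 0#
  1+1≈0⇒-4≈0 1+1≈0 = trans
    (solve 0 (con -[1+ 3 ] := con -[1+ 1 ] :* (con (+ 1) :+ con (+ 1))) refl)
    (_ ⊡ trans (+-cong 1-homo 1-homo) 1+1≈0)

  1+i-*-M : ∀ {i a b} → i * i ≈ - 1# →
    (1# + i) * (a + b * i) ≈ proj₁ (M (a , b)) + proj₂ (M (a , b)) * i
  1+i-*-M {i} {a} {b} ii≈-1 = trans (distribʳ (a + b * i) 1# i) (trans (+-congʳ (*-identityˡ _))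
    (combination
      (solve 3 (λ i a b →
        a :+ b :* i :+ i :* (a :+ b :* i) :- (proj₁ (M′ (a , b)) :+ proj₂ (M′ (a , b)) :* i) :=
        b :* (i :* i :+ con (+ 1))) refl i a b)
      (_ ⊡ square≈-1 ii≈-1)))

  -- Multiply δ y + i y = ε i by ε δ (δ - i).
  imaginary-unit : ∀ {δ ε i y} → δ * δ ≈ 1# → ε * ε ≈ 1# → i * i ≈ - 1# →
    δ * y + y * i ≈ ε * i → ε * (δ * (y + y)) - δ ≈ i
  imaginary-unit {δ} {ε} {i} {y} δδ εε ii eq = combination
    (solve 4 (λ δ ε i y →
        ε :* (δ :* (y :+ y)) :- δ :- i :=
        ε :* δ :* (δ :- i) :* (δ :* y :+ y :* i :- ε :* i)
        :+ ((:- (ε :* δ :* y) :+ i :* ε :* ε) :* (δ :* δ :- con (+ 1))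
        :+ ((i :+ δ) :* (ε :* ε :- con (+ 1))
        :+ (ε :* δ :* y :- δ :* ε :* ε) :* (i :* i :+ con (+ 1))))) refl δ ε i y)
    (_ ⊡ difference eq ⊞ _ ⊡ square≈1 δδ ⊞ _ ⊡ square≈1 εε ⊞ _ ⊡ square≈-1 ii)

  -- The pair `(δ * y , y)` stands for (1 + i)ᵗ, so `period` expresses M²ᵗ v = v. The number `e` is
  -- the copy of i in the base ring, and the aim is to show that Mᵗ acts on v as a sign.
  module Eigenvector {δ ε e y a b}
    (δδ≈1 : δ * δ ≈ 1#) (εε≈1 : ε * ε ≈ 1#) (ee≈-1 : e * e ≈ - 1#)
    (y[δ+e]≈εe : δ * y + y * e ≈ ε * e)
    (period : (δ * y , y) ⊗ (δ * y , y) ⊗ (a , b) ≋ (a , b)) where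

    private
      δδ-1≈0 = square≈1 δδ≈1
      εε-1≈0 = square≈1 εε≈1
      ee+1≈0 = square≈-1 ee≈-1
      y[δ+e]-εe≈0 = difference y[δ+e]≈εe

      -- Square `y[δ+e]≈εe`: as δ² = ε² = 1 and e² = -1, the left side becomes 2y²δe and the right
      -- side -1.
      2yyδe+1≈0 : (y * y + y * y) * δ * e + ⟦ + 1 ⟧ ≈ 0#
      2yyδe+1≈0 = trans
        (solve 4 (λ δ ε e y →
          (y :* y :+ y :* y) :* δ :* e :+ con (+ 1) :=
          (δ :* y :+ y :* e :+ ε :* e) :* (δ :* y :+ y :* e :- ε :* e)
          :+ ((e :* e) :* (ε :* ε :- con (+ 1))
          :+ ((con (+ 1) :- y :* y) :* (e :* e :+ con (+ 1))
          :+ :- (y :* y) :* (δ :* δ :- con (+ 1))))) refl δ ε e y)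
        (_ ⊡ y[δ+e]-εe≈0 ⊞ _ ⊡ εε-1≈0 ⊞ _ ⊡ ee+1≈0 ⊞ _ ⊡ δδ-1≈0)

      2yyδ≈e : (y * y + y * y) * δ ≈ e
      2yyδ≈e = combination
        (solve 3 (λ δ e y →
          (y :* y :+ y :* y) :* δ :- e :=
          :- e :* ((y :* y :+ y :* y) :* δ :* e :+ con (+ 1))
          :+ (y :* y :+ y :* y) :* δ :* (e :* e :+ con (+ 1))) refl δ e y)
        (_ ⊡ 2yyδe+1≈0 ⊞ _ ⊡ ee+1≈0)

      -- The square of δy + yi is 2δy²i, that is, e i. Fixing a + bi under multiplication by e i
      -- gives b = ea in the second coordinate.
      b≈ea : b ≈ e * a
      b≈ea = combination
        (solve 5 (λ δ e y a b →
          b :- e :* a :=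
          :- con (+ 1) :* (proj₂ ((δ :* y , y) ⊗′ ((δ :* y , y) ⊗′ (a , b))) :- b)
          :+ (a :* ((y :* y :+ y :* y) :* δ :- e)
          :+ y :* y :* b :* (δ :* δ :- con (+ 1)))) refl δ e y a b)
        (_ ⊡ difference (proj₂ period) ⊞ _ ⊡ difference 2yyδ≈e ⊞ _ ⊡ δδ-1≈0)

      -- Multiply `y[δ+e]≈εe` by -δe.
      y[δ-e]≈δε : y * (δ - e) ≈ δ * ε
      y[δ-e]≈δε = combination
        (solve 4 (λ δ ε e y →
          y :* (δ :- e) :- δ :* ε :=
          :- (δ :* e) :* (δ :* y :+ y :* e :- ε :* e)
          :+ ((δ :* y :- δ :* ε) :* (e :* e :+ con (+ 1))
          :+ e :* y :* (δ :* δ :- con (+ 1)))) refl δ ε e y)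
        (_ ⊡ y[δ+e]-εe≈0 ⊞ _ ⊡ ee+1≈0 ⊞ _ ⊡ δδ-1≈0)

    eigenvector : (δ * y , y) ⊗ (a , b) ≋ (δ * ε) • (a , b)
    eigenvector =
        combination
          (solve 6 (λ δ ε e y a b →
            proj₁ ((δ :* y , y) ⊗′ (a , b)) :- δ :* ε :* a :=
            :- y :* (b :- e :* a)
            :+ a :* (y :* (δ :- e) :- δ :* ε)) refl δ ε e y a b)
          (_ ⊡ difference b≈ea ⊞ _ ⊡ difference y[δ-e]≈δε)
      , combination
          (solve 6 (λ δ ε e y a b →
            proj₂ ((δ :* y , y) ⊗′ (a , b)) :- δ :* ε :* b :=
            b :* (y :* (δ :- e) :- δ :* ε)
            :+ (y :* e :* (b :- e :* a)
            :+ y :* a :* (e :* e :+ con (+ 1)))) refl δ ε e y a b)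
          (_ ⊡ difference y[δ-e]≈δε ⊞ _ ⊡ difference b≈ea ⊞ _ ⊡ ee+1≈0)

-- Inverses modulo a prime.

module PrimeField (p : ℕ) .{{_ : NonZero p}} (prime : Prime p) where

  open IntegersModulo p hiding (commutativeRing)
  open CommutativeRing (IntegersModulo.commutativeRing p)

  residueMorphism : ℤ-rawRing -Raw-AlmostCommutative⟶ fromCommutativeRing (IntegersModulo.commutativeRing p)
  residueMorphism = record
    { ⟦_⟧ = residue p ; +-homo = residue-+ ; *-homo = residue-* ; -‿homo = residue-neg
    ; 0-homo = refl ; 1-homo = refl }

  private
    *-residue : ∀ a z → residue p (lift a ℤ.* z) ≡ a * residue p z
    *-residue a z = ≡.trans (residue-* (lift a) z) (≡.cong (_* residue p z) (residue-lift a))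

    pos-1+* : ∀ x m y n → 1 ℕ.+ x ℕ.* m ≡ y ℕ.* n → + 1 ℤ.+ + x ℤ.* + m ≡ + y ℤ.* + n
    pos-1+* x m y n eq = ≡.trans (≡.cong (ℤ._+_ (+ 1)) (≡.sym (ℤ.pos-* x m)))
      (≡.trans (≡.cong +_ eq) (ℤ.pos-* y n))

  inverse : ∀ {a} → a ≢ 0# → ∃ λ b → a * b ≡ 1#
  inverse {a} a≢0 = inverse′ (coprime-Bézout (prime⇒coprime prime {{ℕ.≢-nonZero toℕa≢0}} (toℕ<n a)))
    where
    toℕa≢0 : toℕ a ≢ 0
    toℕa≢0 eq = a≢0 (≡.trans (≡.sym (residue-lift a)) (≡.cong (λ n → residue p (+ n)) eq))

    lemma₁ : ∀ a y → a ℤ.* (ℤ.- y) ℤ.- + 1 ≡ ℤ.- (+ 1 ℤ.+ y ℤ.* a)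
    lemma₁ = solve-∀

    lemma₂ : ∀ a → (+ 1 ℤ.+ a) ℤ.- + 1 ≡ a
    lemma₂ = solve-∀

    inverse′ : Bézout.Identity 1 p (toℕ a) → ∃ λ b → a * b ≡ 1#
    -- Here 1 + y a = x p, so the inverse of a is -y; in the other case 1 + x p = y a, and it is y.
    inverse′ (Bézout.+- x y eq) = residue p (ℤ.- + y) ,
      ≡.trans (≡.sym (*-residue a (ℤ.- + y))) (residue-cong {lift a ℤ.* ℤ.- + y} {+ 1} (congruent (ℤ.divides (ℤ.- + x)
        (≡.trans (lemma₁ (lift a) (+ y))
        (≡.trans (≡.cong ℤ.-_ (pos-1+* y (toℕ a) x p eq)) (ℤ.neg-distribˡ-* (+ x) (+ p)))))))
    inverse′ (Bézout.-+ x y eq) = residue p (+ y) ,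
      ≡.trans (≡.sym (*-residue a (+ y))) (residue-cong {lift a ℤ.* + y} {+ 1} (congruent (ℤ.divides (+ x)
        (≡.trans (≡.cong (ℤ._- + 1) (≡.trans (ℤ.*-comm (lift a) (+ y)) (≡.sym (pos-1+* x p y (toℕ a) eq))))
          (lemma₂ (+ x ℤ.* + p))))))

  *-cancelʳ-≡1 : ∀ {a c} → a ≢ 0# → c * a ≡ a → c ≡ 1#
  *-cancelʳ-≡1 {a} {c} a≢0 ca≡a with b , ab≡1 ← inverse a≢0 = begin
    c           ≡⟨ *-identityʳ c ⟨
    c * 1#      ≡⟨ ≡.cong (c *_) ab≡1 ⟨
    c * (a * b) ≡⟨ *-assoc c a b ⟨
    (c * a) * b ≡⟨ ≡.cong (_* b) ca≡a ⟩
    a * b       ≡⟨ ab≡1 ⟩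
    1#          ∎
    where open ≡.≡-Reasoning

-- The prime subfield of the field with p² elements.

module Characteristic {c ℓ₁ ℓ₂} (F : HeytingField c ℓ₁ ℓ₂) where

  open HeytingField F using (heytingCommutativeRing; tight; #-irrefl)
  open HeytingProperties heytingCommutativeRing using (1#0; x#0y#0→xy#0)

  R : CommutativeRing c ℓ₁
  R = HeytingCommutativeRing.commutativeRing heytingCommutativeRing

  open CommutativeRing R
  open Mult semiring using (×-homo-+; ×1-homo-*; ×-congˡ; ×-homo-1) renaming (_×_ to _·_)
  open Sum +-commutativeMonoid using (sum; sum-permute; sum-cong-≋; sum-replicate; ∑-distrib-+)
  open GroupProperties +-group using (∙-cancelˡ; inverseʳ-unique)

  1≉0 : ¬ 1# ≈ 0#
  1≉0 1≈0 = #-irrefl 1≈0 1#0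

  -- By tightness it is enough to refute that x is apart from 0, and the square of such an x would
  -- be apart from 0 as well.
  square≈0⇒≈0 : ∀ {x} → x * x ≈ 0# → x ≈ 0#
  square≈0⇒≈0 {x} xx≈0 = proj₁ (tight x 0#) (λ x#0 → #-irrefl xx≈0 (x#0y#0→xy#0 x#0 x#0))

  -- Translation by 1 permutes F, so Σ x = Σ (x + 1) = Σ x + q·1.
  ·1≈0 : ∀ {q} → IsGF F q → q · 1# ≈ 0#
  ·1≈0 {q} isGF = sym (∙-cancelˡ (sum from) 0# (q · 1#) (begin
    sum from + 0#                              ≈⟨ +-identityʳ (sum from) ⟩
    sum from                                   ≈⟨ sum-permute from translation ⟩
    sum (λ j → from (to (from j + 1#)))        ≈⟨ sum-cong-≋ (λ j → from∘to (from j + 1#)) ⟩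
    sum (λ j → from j + 1#)                    ≈⟨ ∑-distrib-+ from (λ _ → 1#) ⟩
    sum from + sum {q} (replicate q 1#)        ≈⟨ +-congˡ (sum-replicate q) ⟩
    sum from + q · 1#                          ∎))
    where
    open ≈-Reasoning setoid
    open Inverse isGF using (to; from; to-cong; strictlyInverseˡ; strictlyInverseʳ)

    from∘to : ∀ x → from (to x) ≈ x
    from∘to = strictlyInverseʳ

    cancel : ∀ {x y} → x + y ≈ 0# → ∀ j → to (from (to (from j + x)) + y) ≡ j
    cancel {x} {y} x+y≈0 j = ≡.trans (to-cong (begin
      from (to (from j + x)) + y ≈⟨ +-congʳ (from∘to (from j + x)) ⟩
      (from j + x) + y           ≈⟨ +-assoc (from j) x y ⟩
      from j + (x + y)           ≈⟨ +-congˡ x+y≈0 ⟩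
      from j + 0#                ≈⟨ +-identityʳ (from j) ⟩
      from j                     ∎)) (strictlyInverseˡ j)

    translation : Permutation q q
    translation = permutation (λ j → to (from j + 1#)) (λ j → to (from j + - 1#))
      (cancel (-‿inverseˡ 1#)) (cancel (-‿inverseʳ 1#))

  module PrimeSubfield (p : ℕ) .{{_ : NonZero p}} (prime : Prime p) (isGF : IsGF F (p ℕ.^ 2)) where

    module Zₚ = CommutativeRing (IntegersModulo.commutativeRing p)
    open ≈-Reasoning setoid

    -- The square of p·1 is p²·1, which vanishes because the field has p² elements; a field has no
    -- nonzero nilpotents.
    p·1≈0 : p · 1# ≈ 0#
    p·1≈0 = square≈0⇒≈0 (begin
      p · 1# * p · 1#   ≈⟨ ×1-homo-* p p ⟨
      (p ℕ.* p) · 1#    ≈⟨ ×-congˡ (≡.cong (p ℕ.*_) (≡.sym (ℕ.*-identityʳ p))) ⟩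
      (p ℕ.^ 2) · 1#    ≈⟨ ·1≈0 isGF ⟩
      0#                ∎)

    φ : Fin p → Carrier
    φ a = toℕ a · 1#

    φ-residue : ∀ n → φ (residue p (+ n)) ≈ n · 1#
    φ-residue n = begin
      φ (residue p (+ n))                          ≈⟨ ×-congˡ (toℕ-fromℕ< (n%ℕd<d (+ n) p)) ⟩
      (n ℕ.% p) · 1#                               ≈⟨ +-identityʳ _ ⟨
      (n ℕ.% p) · 1# + 0#                          ≈⟨ +-congˡ (zeroʳ _) ⟨
      (n ℕ.% p) · 1# + (n ℕ./ p) · 1# * 0#         ≈⟨ +-congˡ (*-congˡ p·1≈0) ⟨
      (n ℕ.% p) · 1# + (n ℕ./ p) · 1# * p · 1#     ≈⟨ +-congˡ (×1-homo-* (n ℕ./ p) p) ⟨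
      (n ℕ.% p) · 1# + (n ℕ./ p ℕ.* p) · 1#        ≈⟨ ×-homo-+ 1# (n ℕ.% p) (n ℕ./ p ℕ.* p) ⟨
      (n ℕ.% p ℕ.+ n ℕ./ p ℕ.* p) · 1#             ≈⟨ ×-congˡ (≡.sym (m≡m%n+[m/n]*n n p)) ⟩
      n · 1#                                       ∎

    φ-+ : ∀ a b → φ (a Zₚ.+ b) ≈ φ a + φ b
    φ-+ a b = trans (φ-residue (toℕ a ℕ.+ toℕ b)) (×-homo-+ 1# (toℕ a) (toℕ b))

    φ-* : ∀ a b → φ (a Zₚ.* b) ≈ φ a * φ b
    φ-* a b = begin
      φ (a Zₚ.* b)                        ≈⟨ reflexive (≡.cong (φ ∘ residue p) (≡.sym (ℤ.pos-* (toℕ a) (toℕ b)))) ⟩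
      φ (residue p (+ (toℕ a ℕ.* toℕ b))) ≈⟨ φ-residue (toℕ a ℕ.* toℕ b) ⟩
      (toℕ a ℕ.* toℕ b) · 1#              ≈⟨ ×1-homo-* (toℕ a) (toℕ b) ⟩
      φ a * φ b                           ∎

    φ-0 : φ Zₚ.0# ≈ 0#
    φ-0 = φ-residue 0

    φ-1 : φ Zₚ.1# ≈ 1#
    φ-1 = trans (φ-residue 1) (×-homo-1 1#)

    φ-neg : ∀ a → φ (Zₚ.- a) ≈ - φ a
    φ-neg a = inverseʳ-unique (φ a) (φ (Zₚ.- a)) (begin
      φ a + φ (Zₚ.- a)   ≈⟨ φ-+ a (Zₚ.- a) ⟨
      φ (a Zₚ.+ Zₚ.- a)  ≈⟨ reflexive (≡.cong φ (Zₚ.-‿inverseʳ a)) ⟩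
      φ Zₚ.0#            ≈⟨ φ-0 ⟩
      0#                 ∎)

    open PrimeField p prime using (inverse)
    open IntegersModulo p using (residue-+; residue-*; residue-neg)

    -- A nonzero residue has an inverse modulo p, so sending it to 0 would collapse 1 to 0 in F.
    φ≈0⇒≡0 : ∀ a → φ a ≈ 0# → a ≡ Zₚ.0#
    φ≈0⇒≡0 a φa≈0 = decidable-stable (a Fin.≟ Zₚ.0#) λ a≢0 →
      let b , ab≡1 = inverse a≢0 in 1≉0 (begin
        1#            ≈⟨ φ-1 ⟨
        φ Zₚ.1#       ≈⟨ reflexive (≡.cong φ ab≡1) ⟨
        φ (a Zₚ.* b)  ≈⟨ φ-* a b ⟩
        φ a * φ b     ≈⟨ *-congʳ φa≈0 ⟩
        0# * φ b      ≈⟨ zeroˡ (φ b) ⟩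
        0#            ∎)

    φ-injective : ∀ {a b} → φ a ≈ φ b → a ≡ b
    φ-injective {a} {b} φa≈φb = x∙y⁻¹≈ε⇒x≈y a b (φ≈0⇒≡0 (a Zₚ.- b) (begin
      φ (a Zₚ.- b)      ≈⟨ φ-+ a (Zₚ.- b) ⟩
      φ a + φ (Zₚ.- b)  ≈⟨ +-cong φa≈φb (φ-neg b) ⟩
      φ b + - φ b       ≈⟨ -‿inverseʳ (φ b) ⟩
      0#                ∎))
      where open RingProperties Zₚ.ring using (x∙y⁻¹≈ε⇒x≈y)

    ℤ⟶F : ℤ-rawRing -Raw-AlmostCommutative⟶ fromCommutativeRing R
    ℤ⟶F = record
      { ⟦_⟧    = φ ∘ residue p
      ; +-homo = λ y z → trans (reflexive (≡.cong φ (residue-+ y z))) (φ-+ (residue p y) (residue p z))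
      ; *-homo = λ y z → trans (reflexive (≡.cong φ (residue-* y z))) (φ-* (residue p y) (residue p z))
      ; -‿homo = λ z → trans (reflexive (≡.cong φ (residue-neg z))) (φ-neg (residue p z))
      ; 0-homo = φ-0
      ; 1-homo = φ-1
      }

IsImaginaryUnit : ∀ {c ℓ₁ ℓ₂} (F : HeytingField c ℓ₁ ℓ₂) → HeytingField.Carrier F → Set ℓ₁
IsImaginaryUnit F i = i * i ≈ - 1#
  where open HeytingField F

-- Orbits of M modulo p and the lengths of secondary cycles.

module SubAddCycles (p : ℕ) .{{_ : NonZero p}} (prime : Prime p)
  (t : ℕ) (order : IsOrderOf-4 p t) where

  open ≡ using (cong; cong₂; sym; trans; subst)
  open PrimeField p prime using (residueMorphism; *-cancelʳ-≡1)
  open CommutativeRing (IntegersModulo.commutativeRing p) using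
    (_+_; _*_; -_; 0#; 1#; semiring; ring; *-assoc; *-identityˡ; *-identityʳ; zeroˡ; zeroʳ; -‿inverseʳ; +-identityˡ)
  open SubAdd (IntegersModulo.commutativeRing p) residueMorphism
  open Exp semiring using (_^_)
  open IsOrder order

  -4# : Fin p
  -4# = residue p -[1+ 3 ]

  ≋⇒≡ : ∀ {u v} → u ≋ v → u ≡ v
  ≋⇒≡ (eq₁ , eq₂) = cong₂ _,_ eq₁ eq₂

  1•v≡v : ∀ v → 1# • v ≡ v
  1•v≡v (a , b) = cong₂ _,_ (*-identityˡ a) (*-identityˡ b)

  0•v≡0 : ∀ v → 0# • v ≡ (0# , 0#)
  0•v≡0 (a , b) = cong₂ _,_ (zeroˡ a) (zeroˡ b)

  •-assoc : ∀ c d v → c • (d • v) ≡ (c * d) • v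
  •-assoc c d (a , b) = cong₂ _,_ (sym (*-assoc c d a)) (sym (*-assoc c d b))

  •-fixed : ∀ {c v} → v ≢ (0# , 0#) → c • v ≡ v → c ≡ 1#
  •-fixed {c} {a , b} v≢0 cv≡v with a Fin.≟ 0# | b Fin.≟ 0#
  ... | no a≢0     | _          = *-cancelʳ-≡1 a≢0 (cong proj₁ cv≡v)
  ... | yes _      | no b≢0     = *-cancelʳ-≡1 b≢0 (cong proj₂ cv≡v)
  ... | yes ≡.refl | yes ≡.refl = contradiction ≡.refl v≢0

  fold-M⁴ : ∀ v n → fold v M (n ℕ.* 4) ≡ (-4# ^ n) • v
  fold-M⁴ v zero    = sym (1•v≡v v)
  fold-M⁴ v (suc n) = begin
    M (M (M (M (fold v M (n ℕ.* 4))))) ≡⟨ ≋⇒≡ (M⁴≋-4• _) ⟩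
    -4# • fold v M (n ℕ.* 4)           ≡⟨ cong (-4# •_) (fold-M⁴ v n) ⟩
    -4# • (-4# ^ n) • v                ≡⟨ •-assoc -4# (-4# ^ n) v ⟩
    (-4# ^ suc n) • v                  ∎
    where open ≡.≡-Reasoning

  -- Reduces every power of `M` to its value at (1 , 0), the pair of coordinates of (1 + i)ⁿ.
  fold-M-⊗ : ∀ n v → fold v M n ≡ fold (1# , 0#) M n ⊗ v
  fold-M-⊗ zero    v = sym (≋⇒≡ (⊗-identityˡ v))
  fold-M-⊗ (suc n) v = trans (cong M (fold-M-⊗ n v)) (≋⇒≡ (M-⊗ (fold (1# , 0#) M n) v))

  private
    fold≡^ : ∀ n → fold 1# (-4# *_) n ≡ -4# ^ n
    fold≡^ zero    = ≡.refl
    fold≡^ (suc n) = cong (-4# *_) (fold≡^ n)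

  -- The powers of -4 form the orbit of 1 under multiplication by -4, so `t` is a minimal period and
  -- divides every period.
  t∣ : ∀ n → -4# ^ n ≡ 1# → t ∣ n
  t∣ n eq = Orbit.minimalPeriod∣period (-4# *_) 1#
    (positive , trans (fold≡^ t) x^n≈1 ,
      λ m 0<m m<t per → ℕ.<⇒≱ m<t (minimal m 0<m (trans (sym (fold≡^ m)) per)))
    (trans (fold≡^ n) eq)

  -- If -1 = 1 then 2 = 0 and so -4 = 0; since t is positive, (-4)ᵗ = 1 would read 0 = 1.
  -1≢1 : 1# ≢ 0# → - 1# ≢ 1#
  -1≢1 1≢0 -1≡1 = 1≢0 (1≡0 t positive x^n≈1)
    where
    -4≡0 : -4# ≡ 0#
    -4≡0 = 1+1≈0⇒-4≈0 (trans (cong (λ a → 1# + a) (sym -1≡1)) (-‿inverseʳ 1#))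

    1≡0 : ∀ n → 0 ℕ.< n → -4# ^ n ≡ 1# → 1# ≡ 0#
    1≡0 (suc n) _ eq = trans (sym eq) (trans (cong (λ a → a * (-4# ^ n)) -4≡0) (zeroˡ (-4# ^ n)))

  module Nonzero (v : Pair) (v≢0 : v ≢ (0# , 0#)) where

    open Orbit M v

    -- With `n` also `4 * n` is a period, and M⁴ⁿ is the scalar (-4)ⁿ. A scalar that fixes a nonzero
    -- vector is 1.
    period⇒t∣ : ∀ n → IsPeriod n → t ∣ n
    period⇒t∣ n per = t∣ n (•-fixed v≢0 (trans (sym (fold-M⁴ v n))
      (trans (cong (fold v M) (ℕ.*-comm n 4)) (*-period {n} per 4))))

    4t-period : IsPeriod (4 ℕ.* t)
    4t-period = trans (cong (fold v M) (ℕ.*-comm 4 t))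
      (trans (fold-M⁴ v t) (trans (cong (_• v) x^n≈1) (1•v≡v v)))

    open PeriodsBetween positive period⇒t∣ 4t-period public

    2t-not-period : 2 ∣ t → ¬ IsPeriod (2 ℕ.* t)
    2t-not-period (divides s eq) per = ℕ.<⇒≱ s<t (minimal s 0<s
        (•-fixed v≢0 (trans (sym (fold-M⁴ v s)) (trans (cong (fold v M) s*4≡2*t) per))))
      where
      s*4≡2*t : s ℕ.* 4 ≡ 2 ℕ.* t
      s*4≡2*t = trans (sym (ℕ.*-assoc s 2 2)) (trans (cong (ℕ._* 2) (sym eq)) (ℕ.*-comm t 2))
      0<s : 0 ℕ.< s
      0<s = ℕ.n≢0⇒n>0 λ { ≡.refl → contradiction positive (λ 0<t → ℕ.n≮0 (subst (0 ℕ.<_) eq 0<t)) }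
      s<t : s ℕ.< t
      s<t = subst (s ℕ.<_) (sym eq) (ℕ.m<m*n s 2 {{ℕ.>-nonZero 0<s}} ℕ.≤-refl)

  module Secondary (C : DirectedCycle (Γ p)) (secondary : IsSecondary t C) where

    open FunctionalDigraph (Γ p) M (λ eq → eq) (λ _ → ≡.refl) C
    open DirectedCycle C using (vertex; length)

    v : Pair
    v = vertex start

    open Orbit M v

    v≢0 : v ≢ (0# , 0#)
    -- The zero vector is a fixed point of `M`, so its cycle would be a loop.
    v≢0 v≡0 = proj₂ secondary (length≡minimalPeriod
      (z<s , trans (cong M v≡0) (trans M0≡0 (sym v≡0)) , λ { (suc _) _ (ℕ.s<s ()) }))
      where
      M0≡0 : M (0# , 0#) ≡ (0# , 0#)
      M0≡0 = cong₂ _,_ (-‿inverseʳ 0#) (+-identityˡ 0#)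

    open Nonzero v v≢0

    2t-period : IsPeriod (2 ℕ.* t)
    -- If `2 * t` were not a period, the minimal period would be `4 * t` and the cycle primary;
    -- decidable equality of vertices removes the double negation.
    2t-period = decidable-stable (≡-dec Fin._≟_ Fin._≟_ _ _) λ ¬2t →
      proj₁ secondary (length≡minimalPeriod (4t-minimal ¬2t))

    t-odd : ¬ 2 ∣ t
    t-odd 2∣t = 2t-not-period 2∣t 2t-period

    length≡t : fold v M t ≡ 1# • v → length ≡ t
    length≡t eq = length≡minimalPeriod (t-minimal (trans eq (1•v≡v v)))

    length≡2t : fold v M t ≡ (- 1#) • v → length ≡ 2 ℕ.* t
    length≡2t eq = length≡minimalPeriod (2t-minimal ¬t 2t-period)
      where
      ¬t : ¬ IsPeriod t
      ¬t per = -1≢1 1≢0 (•-fixed v≢0 (trans (sym eq) per))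
        where
        1≢0 : 1# ≢ 0#
        1≢0 1≡0 = v≢0 (trans (sym (1•v≡v v)) (trans (cong (_• v) 1≡0) (0•v≡0 v)))

  -1*-1≡1 : - 1# * - 1# ≡ 1#
  -1*-1≡1 = trans (-1*x≈-x (- 1#)) (-‿involutive 1#)
    where open RingProperties ring using (-1*x≈-x; -‿involutive)

  private
    -- With t = r + 4q, the power M⁴ᵠ is the scalar (-4)ᵠ, which leaves only r applications of `M`.
    fold-M-% : ∀ v r → t % 4 ≡ r → fold v M t ≡ fold ((-4# ^ (t ℕ./ 4)) • v) M r
    fold-M-% v r eq = begin
      fold v M t                             ≡⟨ cong (fold v M) (m≡m%n+[m/n]*n t 4) ⟩
      fold v M (t % 4 ℕ.+ t ℕ./ 4 ℕ.* 4)     ≡⟨ fold-+ v M (t % 4) ⟩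
      fold (fold v M (t ℕ./ 4 ℕ.* 4)) M (t % 4) ≡⟨ cong₂ (λ u n → fold u M n) (fold-M⁴ v (t ℕ./ 4)) eq ⟩
      fold ((-4# ^ (t ℕ./ 4)) • v) M r       ∎
      where open ≡.≡-Reasoning

  t%4≡1⇒fold-M : t % 4 ≡ 1 → ∃ λ y → fold (1# , 0#) M t ≡ (1# * y , y)
  t%4≡1⇒fold-M eq = _ , trans (fold-M-% _ 1 eq) (≋⇒≡ (M-axis (*-identityʳ x) (zeroʳ x)))
    where x = -4# ^ (t ℕ./ 4)

  t%4≡3⇒fold-M : t % 4 ≡ 3 → ∃ λ y → fold (1# , 0#) M t ≡ (- 1# * y , y)
  t%4≡3⇒fold-M eq = _ , trans (fold-M-% _ 3 eq) (≋⇒≡ (M³-axis (*-identityʳ x) (zeroʳ x)))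
    where x = -4# ^ (t ℕ./ 4)

  -- Comparison with the powers of 1 + i in the extension field.

  module InField {c ℓ₁ ℓ₂} (F : HeytingField c ℓ₁ ℓ₂) (isGF : IsGF F (p ℕ.^ 2))
    (i : HeytingField.Carrier F)
    (ii≈-1 : IsImaginaryUnit F i) where

    open Characteristic.PrimeSubfield F p prime isGF using
      (φ; φ-+; φ-*; φ-0; φ-1; φ-neg; φ-injective; ℤ⟶F)
    module 𝔽 = CommutativeRing (Characteristic.R F)
    open 𝔽 using (_≈_) renaming (_+_ to _+ᶠ_; _*_ to _*ᶠ_; -_ to -ᶠ_; 1# to 1ᶠ)
    open Exp 𝔽.semiring using () renaming (_^_ to _^ᶠ_)
    open ≈-Reasoning 𝔽.setoid

    1+i-^ : ∀ n → let a , b = fold (1# , 0#) M n in (1ᶠ +ᶠ i) ^ᶠ n ≈ φ a +ᶠ φ b *ᶠ i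
    1+i-^ zero    = 𝔽.sym (begin
      φ 1# +ᶠ φ 0# *ᶠ i  ≈⟨ 𝔽.+-cong φ-1 (𝔽.*-congʳ φ-0) ⟩
      1ᶠ +ᶠ 𝔽.0# *ᶠ i    ≈⟨ 𝔽.+-congˡ (𝔽.zeroˡ i) ⟩
      1ᶠ +ᶠ 𝔽.0#         ≈⟨ 𝔽.+-identityʳ 1ᶠ ⟩
      1ᶠ                 ∎)
    1+i-^ (suc n) with a , b ← fold (1# , 0#) M n | ih ← 1+i-^ n = begin
      (1ᶠ +ᶠ i) *ᶠ (1ᶠ +ᶠ i) ^ᶠ n             ≈⟨ 𝔽.*-congˡ ih ⟩
      (1ᶠ +ᶠ i) *ᶠ (φ a +ᶠ φ b *ᶠ i)          ≈⟨ SubAdd.1+i-*-M (Characteristic.R F) ℤ⟶F ii≈-1 ⟩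
      (φ a +ᶠ -ᶠ φ b) +ᶠ (φ a +ᶠ φ b) *ᶠ i    ≈⟨ 𝔽.+-cong (𝔽.trans (φ-+ a (- b)) (𝔽.+-congˡ (φ-neg b))) (𝔽.*-congʳ (φ-+ a b)) ⟨
      φ (a + - b) +ᶠ φ (a + b) *ᶠ i           ∎

    fold-M-t : ∀ δ ε {y} → δ * δ ≡ 1# → ε * ε ≡ 1# → fold (1# , 0#) M t ≡ (δ * y , y) →
      (1ᶠ +ᶠ i) ^ᶠ t ≈ φ ε *ᶠ i → ∀ v → fold v M (2 ℕ.* t) ≡ v → fold v M t ≡ (δ * ε) • v
    fold-M-t δ ε {y} δδ≡1 εε≡1 fold≡ 1+i^t≈ v 2t-period =
      trans (fold-M-t≡ v) (≋⇒≡ (Eigenvector.eigenvector {δ} {ε} {e} {y} δδ≡1 εε≡1 ee≡-1 y[δ+e]≡εe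
        (cong proj₁ N⊗N⊗v≡v , cong proj₂ N⊗N⊗v≡v)))
      where
      e : Fin p
      -- The left side of `imaginary-unit` evaluated modulo p, so that `φ` maps it to `i`.
      e = ε * (δ * (y + y)) + - δ

      fold-M-t≡ : ∀ u → fold u M t ≡ (δ * y , y) ⊗ u
      fold-M-t≡ u = trans (fold-M-⊗ t u) (cong (_⊗ u) fold≡)

      N⊗N⊗v≡v : (δ * y , y) ⊗ (δ * y , y) ⊗ v ≡ v
      N⊗N⊗v≡v =
        trans (cong ((δ * y , y) ⊗_) (sym (fold-M-t≡ v)))
        (trans (sym (fold-M-t≡ (fold v M t)))
        (trans (sym (fold-+ v M t))
        (trans (cong (λ n → fold v M (t ℕ.+ n)) (sym (ℕ.+-identityʳ t))) 2t-period)))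

      φ-square : ∀ a → a * a ≡ 1# → φ a *ᶠ φ a ≈ 1ᶠ
      φ-square a eq = 𝔽.trans (𝔽.sym (φ-* a a)) (𝔽.trans (𝔽.reflexive (cong φ eq)) φ-1)

      δy+yi≈εi : φ δ *ᶠ φ y +ᶠ φ y *ᶠ i ≈ φ ε *ᶠ i
      δy+yi≈εi = begin
        φ δ *ᶠ φ y +ᶠ φ y *ᶠ i   ≈⟨ 𝔽.+-congʳ (φ-* δ y) ⟨
        φ (δ * y) +ᶠ φ y *ᶠ i    ≈⟨ 𝔽.reflexive (cong (λ (a , b) → φ a +ᶠ φ b *ᶠ i) fold≡) ⟨
        _                        ≈⟨ 1+i-^ t ⟨
        (1ᶠ +ᶠ i) ^ᶠ t           ≈⟨ 1+i^t≈ ⟩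
        φ ε *ᶠ i                 ∎

      φe≈i : φ e ≈ i
      φe≈i = begin
        φ (ε * (δ * (y + y)) + - δ)                  ≈⟨ φ-+ (ε * (δ * (y + y))) (- δ) ⟩
        φ (ε * (δ * (y + y))) +ᶠ φ (- δ)             ≈⟨ 𝔽.+-cong (φ-* ε (δ * (y + y))) (φ-neg δ) ⟩
        φ ε *ᶠ φ (δ * (y + y)) +ᶠ -ᶠ φ δ             ≈⟨ 𝔽.+-congʳ (𝔽.*-congˡ (φ-* δ (y + y))) ⟩
        φ ε *ᶠ (φ δ *ᶠ φ (y + y)) +ᶠ -ᶠ φ δ          ≈⟨ 𝔽.+-congʳ (𝔽.*-congˡ (𝔽.*-congˡ (φ-+ y y))) ⟩
        φ ε *ᶠ (φ δ *ᶠ (φ y +ᶠ φ y)) +ᶠ -ᶠ φ δ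
          ≈⟨ SubAdd.imaginary-unit (Characteristic.R F) ℤ⟶F (φ-square δ δδ≡1) (φ-square ε εε≡1) ii≈-1 δy+yi≈εi ⟩
        i                                            ∎

      -- The equations that `i` satisfies in F descend to `e` because `φ` is an injective ring
      -- homomorphism.
      ee≡-1 : e * e ≡ - 1#
      ee≡-1 = φ-injective (begin
        φ (e * e)    ≈⟨ φ-* e e ⟩
        φ e *ᶠ φ e   ≈⟨ 𝔽.*-cong φe≈i φe≈i ⟩
        i *ᶠ i       ≈⟨ ii≈-1 ⟩
        -ᶠ 1ᶠ        ≈⟨ 𝔽.-‿cong φ-1 ⟨
        -ᶠ φ 1#      ≈⟨ φ-neg 1# ⟨
        φ (- 1#)     ∎)

      y[δ+e]≡εe : δ * y + y * e ≡ ε * e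
      y[δ+e]≡εe = φ-injective (begin
        φ (δ * y + y * e)         ≈⟨ φ-+ (δ * y) (y * e) ⟩
        φ (δ * y) +ᶠ φ (y * e)    ≈⟨ 𝔽.+-cong (φ-* δ y) (φ-* y e) ⟩
        φ δ *ᶠ φ y +ᶠ φ y *ᶠ φ e  ≈⟨ 𝔽.+-congˡ (𝔽.*-congˡ φe≈i) ⟩
        φ δ *ᶠ φ y +ᶠ φ y *ᶠ i    ≈⟨ δy+yi≈εi ⟩
        φ ε *ᶠ i                  ≈⟨ 𝔽.*-congˡ φe≈i ⟨
        φ ε *ᶠ φ e                ≈⟨ φ-* ε e ⟨
        φ (ε * e)                 ∎)

    φ1*i≈i : φ 1# *ᶠ i ≈ i
    φ1*i≈i = 𝔽.trans (𝔽.*-congʳ φ-1) (𝔽.*-identityˡ i)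

    φ-1*i≈-i : φ (- 1#) *ᶠ i ≈ -ᶠ i
    φ-1*i≈-i = 𝔽.trans (𝔽.*-congʳ (𝔽.trans (φ-neg 1#) (𝔽.-‿cong φ-1))) (-1*x≈-x i)
      where open RingProperties 𝔽.ring using (-1*x≈-x)

theorem7p2 : ∀ {c ℓ₁ ℓ₂} (p : ℕ) .{{_ : NonZero p}} → Prime p → p ≢ 2 →
    (t : ℕ) → IsOrderOf-4 p t →
    (2 ∣ t → (C : DirectedCycle (Γ p)) → ¬ IsSecondary t C)
    ×
    ((F : HeytingField c ℓ₁ ℓ₂) → IsGF F (p ℕ.^ 2) →
    let open FieldNotation F in
    (i : Carrier) → IsChosenI F i →
    (t % 4 ≡ 1 → (1# + i) ^ t ≈ i →
    (C : DirectedCycle (Γ p)) → IsSecondary t C → DirectedCycle.length C ≡ t)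
    ×
    (t % 4 ≡ 3 → (1# + i) ^ t ≈ i →
    (C : DirectedCycle (Γ p)) → IsSecondary t C → DirectedCycle.length C ≡ 2 ℕ.* t)
    ×
    (t % 4 ≡ 1 → (1# + i) ^ t ≈ - i →
    (C : DirectedCycle (Γ p)) → IsSecondary t C → DirectedCycle.length C ≡ 2 ℕ.* t)
    ×
    (t % 4 ≡ 3 → (1# + i) ^ t ≈ - i →
    (C : DirectedCycle (Γ p)) → IsSecondary t C → DirectedCycle.length C ≡ t))
theorem7p2 p p-prime _ t order =
    (λ 2∣t C secondary → Secondary.t-odd C secondary 2∣t)
  , λ F isGF i (ii≈-1 , _) → let open InField F isGF i ii≈-1 in
      -- In each case the first two arguments of `fold-M-t` are δ, which is 1 or -1 as t is 1 or 3
      -- modulo 4, and ε, the sign in (1 + i)ᵗ = ε i. The product δε decides between the lengths t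
      -- and 2t.
      (λ t%4≡1 eq C secondary → let open Secondary C secondary in
        length≡t (≡.trans
          (fold-M-t 1# 1# 1*1≡1 1*1≡1 (proj₂ (t%4≡1⇒fold-M t%4≡1)) (𝔽.trans eq (𝔽.sym φ1*i≈i)) v 2t-period)
          (≡.cong (_• v) 1*1≡1)))
    , (λ t%4≡3 eq C secondary → let open Secondary C secondary in
        length≡2t (≡.trans
          (fold-M-t (- 1#) 1# -1*-1≡1 1*1≡1 (proj₂ (t%4≡3⇒fold-M t%4≡3)) (𝔽.trans eq (𝔽.sym φ1*i≈i)) v 2t-period)
          (≡.cong (_• v) (*-identityʳ (- 1#)))))
    , (λ t%4≡1 eq C secondary → let open Secondary C secondary in
        length≡2t (≡.trans
          (fold-M-t 1# (- 1#) 1*1≡1 -1*-1≡1 (proj₂ (t%4≡1⇒fold-M t%4≡1)) (𝔽.trans eq (𝔽.sym φ-1*i≈-i)) v 2t-period)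
          (≡.cong (_• v) (*-identityˡ (- 1#)))))
    , (λ t%4≡3 eq C secondary → let open Secondary C secondary in
        length≡t (≡.trans
          (fold-M-t (- 1#) (- 1#) -1*-1≡1 -1*-1≡1 (proj₂ (t%4≡3⇒fold-M t%4≡3)) (𝔽.trans eq (𝔽.sym φ-1*i≈-i)) v 2t-period)
          (≡.cong (_• v) -1*-1≡1)))
  where
  open SubAddCycles p p-prime t order
  open CommutativeRing (IntegersModulo.commutativeRing p) using (_*_; -_; 1#; *-identityˡ; *-identityʳ)
  open SubAdd (IntegersModulo.commutativeRing p) (PrimeField.residueMorphism p p-prime) using (_•_)

  1*1≡1 : 1# * 1# ≡ 1#
  1*1≡1 = *-identityˡ 1#
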